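{- Let $\mathbf{A}$ be a normal and quasicomplemented distributive nearlattice. Then every prime $\alpha$-ideal of $A$ is a maximal ideal.
   Context: A distributive nearlattice is a join-semilattice $\langle A,\vee,1\rangle$ with greatest element $1$ in which every principal filter $[a)=\{x\in A\colon a\le x\}$ is a bounded distributive lattice. An ideal of $A$ is a subset $I$ that is downward closed and closed under $\vee$. A prime ideal is a non-empty proper ideal $P$ such that $a\wedge b\in P$ implies $a\in P$ or $b\in P$ whenever $a\wedge b$ exists. A maximal ideal is a non-empty proper ideal $I$ such that for every ideal $J\supseteq I$, $J=I$ or $J=A$. For $a\in A$, $a^{\top}=\{x\in A\colon x\vee a=1\}$ and $a^{\top\top}=\{y\in A\colon y\vee x=1\text{ for all }x\in a^{\top}\}$. An ideal $I$ is an $\alpha$-ideal if for each $a\in A$, $I\cap a^{\top\top}\ne\emptyset$ implies $a\in I$. $\mathbf{A}$ is normal if each prime ideal is contained in a unique maximal ideal. $\mathbf{A}$ is quasicomplemented if for each $a\in A$ there exists $b\in A$ with $a^{\top\top}=b^{\top}$. -}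

module Defs where

open import Level using (Level; suc; _⊔_)
open import Data.Product using (Σ; ∃; _×_; _,_)
open import Data.Sum using (_⊎_)
open import Relation.Nullary using (¬_)
open import Relation.Binary.PropositionalEquality using (_≡_)
open import Relation.Unary using (Pred; _∈_; _∉_; _⊆_)

-- A join-semilattice ⟨A, ∨, 1⟩ with greatest element 1, with order
-- x ≤ y :⟺ x ∨ y ≡ y, such that every principal filter [a) is a
-- bounded distributive lattice (bottom a, top 1, join ∨, meets exist).
record DistNearlattice (ℓ : Level) : Set (suc ℓ) where
  infixl 6 _∨_
  infix 4 _≤_
  field
    Carrier : Set ℓ
    _∨_     : Carrier → Carrier → Carrier
    𝟏       : Carrier
    ∨-assoc : ∀ x y z → (x ∨ y) ∨ z ≡ x ∨ (y ∨ z)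
    ∨-comm  : ∀ x y → x ∨ y ≡ y ∨ x
    ∨-idem  : ∀ x → x ∨ x ≡ x
    ∨-top   : ∀ x → x ∨ 𝟏 ≡ 𝟏

  _≤_ : Carrier → Carrier → Set ℓ
  x ≤ y = x ∨ y ≡ y

  IsMeetIn : Carrier → Carrier → Carrier → Carrier → Set ℓ
  IsMeetIn a m x y =
    a ≤ m × m ≤ x × m ≤ y × (∀ z → a ≤ z → z ≤ x → z ≤ y → z ≤ m)

  field
    filter-meet : ∀ a x y → a ≤ x → a ≤ y → Σ Carrier (λ m → IsMeetIn a m x y)
    filter-distrib : ∀ a x y z m₁ m₂ m₃ → a ≤ x → a ≤ y → a ≤ z →
      IsMeetIn a m₁ x (y ∨ z) → IsMeetIn a m₂ x y → IsMeetIn a m₃ x z →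
      m₁ ≡ m₂ ∨ m₃

  -- m is the meet a ∧ b in A (so "a ∧ b exists" means Σ m, IsMeet m a b)
  IsMeet : Carrier → Carrier → Carrier → Set ℓ
  IsMeet m x y = m ≤ x × m ≤ y × (∀ z → z ≤ x → z ≤ y → z ≤ m)

  Subset : Set (suc ℓ)
  Subset = Pred Carrier ℓ

  _≐_ : Subset → Subset → Set ℓ
  I ≐ J = I ⊆ J × J ⊆ I

  IsIdeal : Subset → Set ℓ
  IsIdeal I = (∀ {x y} → x ≤ y → y ∈ I → x ∈ I)
            × (∀ {x y} → x ∈ I → y ∈ I → (x ∨ y) ∈ I)

  NonEmpty : Subset → Set ℓ
  NonEmpty I = Σ Carrier (λ x → x ∈ I)

  Proper : Subset → Set ℓ
  Proper I = ¬ (∀ x → x ∈ I)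

  IsPrimeIdeal : Subset → Set ℓ
  IsPrimeIdeal P = IsIdeal P × NonEmpty P × Proper P
    × (∀ a b m → IsMeet m a b → m ∈ P → a ∈ P ⊎ b ∈ P)

  IsMaximalIdeal : Subset → Set (suc ℓ)
  IsMaximalIdeal I = IsIdeal I × NonEmpty I × Proper I
    × (∀ (J : Subset) → IsIdeal J → I ⊆ J → (J ≐ I) ⊎ (∀ x → x ∈ J))

  _^⊤ : Carrier → Subset
  (a ^⊤) x = x ∨ a ≡ 𝟏

  _^⊤⊤ : Carrier → Subset
  (a ^⊤⊤) y = ∀ x → x ∈ (a ^⊤) → y ∨ x ≡ 𝟏

  IsαIdeal : Subset → Set ℓ
  IsαIdeal I = IsIdeal I ×
    (∀ a → Σ Carrier (λ x → x ∈ I × x ∈ (a ^⊤⊤)) → a ∈ I)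

  IsNormal : Set (suc ℓ)
  IsNormal = ∀ (P : Subset) → IsPrimeIdeal P →
    Σ Subset (λ M → IsMaximalIdeal M × P ⊆ M ×
      (∀ (M' : Subset) → IsMaximalIdeal M' → P ⊆ M' → M' ≐ M))

  IsQuasicomplemented : Set ℓ
  IsQuasicomplemented = ∀ a → Σ Carrier (λ b → (a ^⊤⊤) ≐ (b ^⊤))

{-# OPTIONS --safe #-}

-- Let P be a prime α-ideal, p ∈ P, and let b be a quasicomplement of a.  The
-- meet d of a ∨ p and b ∨ p in [p) satisfies d^⊤ ⊆ p^⊤, because z ∨ d = 1 puts
-- z ∨ p in a^⊤ ∩ b^⊤ = a^⊤ ∩ a^⊤⊤ = {1}.  Hence d ∈ P as P is an α-ideal, and
-- a ∈ P or b ∈ P as P is prime.  If M is a proper ideal containing P and a ∈ M,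
-- then b ∉ M since a ∨ b = 1, so a ∈ P.  Thus P equals every proper ideal that
-- contains it, in particular the maximal one given by normality.

module Submission where

open import Algebra.Lattice using (Semilattice)
import Algebra.Lattice.Properties.Semilattice as SemilatticeProperties
open import Data.Product using (∃; _,_)
open import Data.Sum as Sum using (_⊎_; fromInj₁)
open import Defs
open import Function using (id; _∘_)
open import Level using (Level)
open import Relation.Binary.Definitions using (_Respects_)
open import Relation.Binary.Lattice using (JoinSemilattice)
import Relation.Binary.Lattice.Properties.JoinSemilattice as JoinSemilatticeProperties
open import Relation.Binary.PropositionalEquality
  using (_≡_; sym; trans; cong; subst; module ≡-Reasoning)
open import Relation.Binary.PropositionalEquality.Algebra using (isMagma)
import Relation.Binary.Reasoning.PartialOrder as PartialOrderReasoning
open import Relation.Nullary using (contradiction)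
open import Relation.Unary using (_∈_; _∉_; _⊆_; _∩_)
open import Relation.Unary.Properties using (≐-trans)

module _ {c ℓ : Level} (S : Semilattice c ℓ) where
  open Semilattice S using (Carrier; _≈_; isEquivalence; comm)
    renaming (_∙_ to _∨_; sym to ≈-sym; trans to ≈-trans)

  -- The standard library orders a join-semilattice by y ≈ y ∨ x instead of x ∨ y ≈ y.
  private
    module Natural = JoinSemilattice
      (SemilatticeProperties.∧-orderTheoreticJoinSemilattice S)

    _≤_ : Carrier → Carrier → Set ℓ
    x ≤ y = x ∨ y ≈ y

    ≤⇒natural : ∀ {x y} → x ≤ y → x Natural.≤ y
    ≤⇒natural {x} {y} x≤y = ≈-trans (≈-sym x≤y) (comm x y)

    natural⇒≤ : ∀ {x y} → x Natural.≤ y → x ≤ y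
    natural⇒≤ {x} {y} y≈y∨x = ≈-trans (comm x y) (≈-sym y≈y∨x)

  joinSemilattice : JoinSemilattice c ℓ ℓ
  joinSemilattice = record
    { _≤_ = _≤_
    ; isJoinSemilattice = record
      { isPartialOrder = record
        { isPreorder = record
          { isEquivalence = isEquivalence
          ; reflexive     = natural⇒≤ ∘ Natural.reflexive
          ; trans         = λ x≤y y≤z →
              natural⇒≤ (Natural.trans (≤⇒natural x≤y) (≤⇒natural y≤z))
          }
        ; antisym = λ x≤y y≤x → Natural.antisym (≤⇒natural x≤y) (≤⇒natural y≤x)
        }
      ; supremum = λ x y →
          natural⇒≤ (Natural.x≤x∨y x y) ,
          natural⇒≤ (Natural.y≤x∨y x y) ,
          λ z x≤z y≤z → natural⇒≤ (Natural.∨-least (≤⇒natural x≤z) (≤⇒natural y≤z))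
      }
    }

module _ {ℓ : Level} (A : DistNearlattice ℓ) where
  open DistNearlattice A

  ∨-semilattice : Semilattice ℓ ℓ
  ∨-semilattice = record
    { isSemilattice = record
      { isBand = record
        { isSemigroup = record { isMagma = isMagma _∨_ ; assoc = ∨-assoc }
        ; idem        = ∨-idem
        }
      ; comm = ∨-comm
      }
    }

  open JoinSemilattice (joinSemilattice ∨-semilattice)
    using (poset; antisym; x≤x∨y; y≤x∨y; ∨-least)
    renaming (refl to ≤-refl; trans to ≤-trans)
  open JoinSemilatticeProperties (joinSemilattice ∨-semilattice) using (∨-monotonic)

  IsMeetIn⇒IsMeet : ∀ {a m x y} → IsMeetIn a m x y → IsMeet m x y
  IsMeetIn⇒IsMeet {a} (a≤m , m≤x , m≤y , greatest) =
    m≤x , m≤y , λ z z≤x z≤y →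
      ≤-trans (x≤x∨y z a)
        (greatest (z ∨ a) (y≤x∨y z a)
          (∨-least z≤x (≤-trans a≤m m≤x)) (∨-least z≤y (≤-trans a≤m m≤y)))

  boundedBelow⇒meet : ∀ {a x y} → a ≤ x → a ≤ y → ∃ λ m → IsMeet m x y
  boundedBelow⇒meet a≤x a≤y with filter-meet _ _ _ a≤x a≤y
  ... | m , meetIn = m , IsMeetIn⇒IsMeet meetIn

  ^⊤-mono : ∀ {x y} → x ≤ y → (x ^⊤) ⊆ (y ^⊤)
  ^⊤-mono {x} {y} x≤y {z} z∨x≡𝟏 = antisym (∨-top (z ∨ y)) (begin
    𝟏      ≡⟨ z∨x≡𝟏 ⟨
    z ∨ x  ≤⟨ ∨-monotonic ≤-refl x≤y ⟩
    z ∨ y  ∎)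
    where open PartialOrderReasoning poset

  ∈[x∨y]^⊤⇒∨∈x^⊤ : ∀ {x y z} → z ∈ ((x ∨ y) ^⊤) → (z ∨ y) ∈ (x ^⊤)
  ∈[x∨y]^⊤⇒∨∈x^⊤ {x} {y} {z} z∨[x∨y]≡𝟏 = begin
    (z ∨ y) ∨ x  ≡⟨ ∨-assoc z y x ⟩
    z ∨ (y ∨ x)  ≡⟨ cong (z ∨_) (∨-comm y x) ⟩
    z ∨ (x ∨ y)  ≡⟨ z∨[x∨y]≡𝟏 ⟩
    𝟏            ∎
    where open ≡-Reasoning

  ^⊤⊆⇒∈^⊤⊤ : ∀ {x y} → (x ^⊤) ⊆ (y ^⊤) → y ∈ (x ^⊤⊤)
  ^⊤⊆⇒∈^⊤⊤ {y = y} x^⊤⊆y^⊤ z z∈x^⊤ = trans (∨-comm y z) (x^⊤⊆y^⊤ z∈x^⊤)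

  -- When a ∧ b exists this says that it is dense, i.e. (a ∧ b)^⊤ = {1}.
  JointlyDense : Carrier → Carrier → Set ℓ
  JointlyDense a b = (a ^⊤) ∩ (b ^⊤) ⊆ (_≡ 𝟏)

  jointlyDense⇒^⊤⊆ : ∀ {a b c d} → JointlyDense a b →
    d ≤ a ∨ c → d ≤ b ∨ c → (d ^⊤) ⊆ (c ^⊤)
  jointlyDense⇒^⊤⊆ dense d≤a∨c d≤b∨c z∈d^⊤ =
    dense (∈[x∨y]^⊤⇒∨∈x^⊤ (^⊤-mono d≤a∨c z∈d^⊤) ,
           ∈[x∨y]^⊤⇒∨∈x^⊤ (^⊤-mono d≤b∨c z∈d^⊤))

  ^⊤⊆^⊤⊤⇒jointlyDense : ∀ {a b} → (b ^⊤) ⊆ (a ^⊤⊤) → JointlyDense a b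
  ^⊤⊆^⊤⊤⇒jointlyDense b^⊤⊆a^⊤⊤ {x} (x∈a^⊤ , x∈b^⊤) =
    trans (sym (∨-idem x)) (b^⊤⊆a^⊤⊤ x∈b^⊤ x x∈a^⊤)

  ^⊤⊤⊆^⊤⇒∨≡𝟏 : ∀ {a b} → (a ^⊤⊤) ⊆ (b ^⊤) → a ∨ b ≡ 𝟏
  ^⊤⊤⊆^⊤⇒∨≡𝟏 a^⊤⊤⊆b^⊤ = a^⊤⊤⊆b^⊤ (^⊤⊆⇒∈^⊤⊤ id)

  proper⇒𝟏∉ : ∀ {I} → IsIdeal I → Proper I → 𝟏 ∉ I
  proper⇒𝟏∉ (down , _) proper 𝟏∈I = proper (λ x → down (∨-top x) 𝟏∈I)

  proper⇒complement∉ : ∀ {I x y} → IsIdeal I → Proper I → x ∨ y ≡ 𝟏 → x ∈ I → y ∉ I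
  proper⇒complement∉ {I} ideal@(_ , ∨-closed) proper x∨y≡𝟏 x∈I y∈I =
    proper⇒𝟏∉ ideal proper (subst I x∨y≡𝟏 (∨-closed x∈I y∈I))

  IsIdeal-resp-≐ : IsIdeal Respects _≐_
  IsIdeal-resp-≐ (I⊆J , J⊆I) (down , ∨-closed) =
    (λ x≤y y∈J → I⊆J (down x≤y (J⊆I y∈J))) ,
    λ x∈J y∈J → I⊆J (∨-closed (J⊆I x∈J) (J⊆I y∈J))

  IsMaximalIdeal-resp-≐ : IsMaximalIdeal Respects _≐_
  IsMaximalIdeal-resp-≐ I≐J@(I⊆J , J⊆I) (ideal , (x , x∈I) , proper , maximal) =
    IsIdeal-resp-≐ I≐J ideal ,
    (x , I⊆J x∈I) ,
    (λ J-total → proper (λ y → J⊆I (J-total y))) ,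
    λ K K-ideal J⊆K →
      Sum.map₁ (λ K≐I → ≐-trans K≐I I≐J) (maximal K K-ideal (J⊆K ∘ I⊆J))

  αIdeal-closed : ∀ {I x y} → IsαIdeal I → (y ^⊤) ⊆ (x ^⊤) → x ∈ I → y ∈ I
  αIdeal-closed {x = x} {y} (_ , α) y^⊤⊆x^⊤ x∈I =
    α y (x , x∈I , ^⊤⊆⇒∈^⊤⊤ y^⊤⊆x^⊤)

  jointlyDense⇒∈primeαIdeal : ∀ {P a b} → IsPrimeIdeal P → IsαIdeal P →
    JointlyDense a b → a ∈ P ⊎ b ∈ P
  jointlyDense⇒∈primeαIdeal {P} {a} {b}
    ((down , _) , (p , p∈P) , _ , prime) P-α dense
    with boundedBelow⇒meet (y≤x∨y a p) (y≤x∨y b p)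
  ... | d , d-meet@(d≤a∨p , d≤b∨p , _) =
    Sum.map (down (x≤x∨y a p)) (down (x≤x∨y b p))
      (prime (a ∨ p) (b ∨ p) d d-meet d∈P)
    where
    d∈P : d ∈ P
    d∈P = αIdeal-closed P-α (jointlyDense⇒^⊤⊆ dense d≤a∨p d≤b∨p) p∈P

  primeαIdeal⊆proper⇒⊇ : IsQuasicomplemented → ∀ {P I} → IsPrimeIdeal P → IsαIdeal P →
    IsIdeal I → Proper I → P ⊆ I → I ⊆ P
  primeαIdeal⊆proper⇒⊇ quasi {I = I} P-prime P-α I-ideal I-proper P⊆I {a} a∈I with quasi a
  ... | b , a^⊤⊤⊆b^⊤ , b^⊤⊆a^⊤⊤ =
    fromInj₁ (λ b∈P → contradiction (P⊆I b∈P) b∉I)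
      (jointlyDense⇒∈primeαIdeal P-prime P-α (^⊤⊆^⊤⊤⇒jointlyDense b^⊤⊆a^⊤⊤))
    where
    b∉I : b ∉ I
    b∉I = proper⇒complement∉ I-ideal I-proper (^⊤⊤⊆^⊤⇒∨≡𝟏 a^⊤⊤⊆b^⊤) a∈I

theorem3p9 : ∀ {ℓ : Level} (A : DistNearlattice ℓ) →
    DistNearlattice.IsNormal A → DistNearlattice.IsQuasicomplemented A →
    ∀ (P : DistNearlattice.Subset A) →
    DistNearlattice.IsPrimeIdeal A P → DistNearlattice.IsαIdeal A P →
    DistNearlattice.IsMaximalIdeal A P
theorem3p9 A normal quasi P P-prime P-α with normal P P-prime
... | M , M-maximal@(M-ideal , _ , M-proper , _) , P⊆M , _ =
  IsMaximalIdeal-resp-≐ A (M⊆P , P⊆M) M-maximal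
  where
  M⊆P : M ⊆ P
  M⊆P = primeαIdeal⊆proper⇒⊇ A quasi P-prime P-α M-ideal M-proper P⊆M
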